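{- The Two-Hydra statement is provable by a proof schema based on a point transition system: there exists a proof schema $\mathbf{P}=(\rho,\{\rho\},\{x,y\},t,\mathrm{Seq},\Pi)$, with parameters $x,y$ and $t(\rho)=(x,y)$, such that $$\mathrm{Seq}(\rho)\;=\;\mathit{pdef},\,\hat H,\,Nx,\,Ny\;\vdash\;P(x,y).$$
   Context: **Language.** Pairwise disjoint sets: parameters $\mathcal{N}$ (variables over the natural numbers), ordinary free variables $V_f$, bound variables $V_b$. Terms are built from these variables, $\bar 0$ (also written $0$), the unary $s$ (successor), $p$ (predecessor) and possibly further function symbols; $\bar 1=s(0)$, $pp\,x=p(p(x))$. $\mathcal{N}$-formulas are first-order formulas over these terms; the predicate symbols include $=,<,>,\le,\ge$, here also a unary $N$ and a binary $P$. $\mathcal{N}$-sequents $\Gamma\vdash\Delta$ consist of multisets of $\mathcal{N}$-formulas. $T_0$ is the set of terms built from parameters, $0,s,p$ only. With $p(0)=0$, $p(s(x))=x$, each parameter-free term of $T_0$ evaluates to (and is identified with) a numeral $s^\alpha(0)$. A parameter assignment $\sigma$ maps parameters to numerals and extends homomorphically to terms, formulas and sequents. A parameter substitution maps finitely many parameters to terms of $T_0$. **The Two-Hydra statement.** $\mathit{pdef}$ is the set of formulas $N0$, $\forall w(w\ge\bar 1\to(Nw\to Npw))$, $\forall w(w\ge\bar 1\to(Npw\to Nw))$. $\hat H$ is the set of formulas $P(0,0)$, $P(\bar 1,0)$, and $(H_a)$ $\forall u\,(Nu\to P(u,\bar 1))$, $(H_b)$ $\forall u\forall v\,(Nu\land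 Nv\to(u>0\land v>\bar 1\to(P(pu,ppv)\to P(u,v))))$, $(H_c)$ $\forall v\,(Nv\to(v>\bar 1\to(P(pv,ppv)\to P(0,v))))$, $(H_d)$ $\forall u\,(Nu\to(u>\bar 1\to(P(pu,ppu)\to P(u,0))))$. **Calculus.** $\mathbf{LK}_{\mathcal N}$ is Gentzen's sequent calculus on multiset $\mathcal{N}$-sequents (multiplicative binary rules, weakening, contraction, cut, the usual rules for $\neg,\land,\lor,\to,\forall,\exists$), where eigenvariables of $\forall_r,\exists_l$ must belong to $V_f$ (never to $\mathcal{N}$). Axioms are atomic sequents: tautological ones, those valid in first-order logic with equality, and the $C$-axioms below. **Conditions.** Atomic conditions are $\top,\bot$, $s^\alpha(v)\,\triangle\,s^\beta(0)$ and $s^\alpha(v)\,\triangle\,s^\beta(w)$ with $v,w$ different parameters, $\triangle\in\{=,<,>,\le,\ge\}$; conditions are Boolean combinations ($\neg,\land,\lor$) of these. A finite set of conditions is a partition if under every parameter assignment exactly one of them is true. **Proof schemata.** To each proof symbol $\rho$ are assigned a finite parameter set $\mathcal{N}(\rho)$ and an $\mathcal{N}$-sequent $\mathrm{Seq}(\rho)$ whose set of parameters is $\mathcal{N}(\rho)$. If $\mathcal N(\rho)=\{m_1,\ldots,m_l\}$ then $\rho(m_1,\ldots,m_l)$ is its proof term, and so is $\rho(m_1,\ldots,m_l)\theta$ for a parameter substitution $\theta$. An $s$-proof corresponding to $\rho$ is an $\mathbf{LK}_{\mathcal N}$-derivation of $\mathrm{Seq}(\rho)$, with set of parameters $\mathcal{N}(\rho)$,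 in which some initial sequents $S'$ are the conclusion of a call inference with premise a proof term $\rho'(k_1,\ldots,k_r)\theta$, where $\mathrm{Seq}(\rho')\theta=S'$. A semi-proof schema is a tuple $(\rho_0,R,\mathcal{N}_0,t,\mathrm{Seq},\Pi)$ with $R$ a finite set of proof symbols, $\rho_0\in R$, $\mathcal{N}_0$ a finite set of parameters, $t(\rho)$ the tuple of parameters of $\rho$ (from $\mathcal{N}_0$), and $\Pi$ assigning to each $\rho\in R$ with $t(\rho)=(m_1,\ldots,m_l)$ a definition $\rho(m_1,\ldots,m_l)=\{C_1:\xi_1(\rho),\ldots,C_k:\xi_k(\rho)\}$, where $\{C_1,\ldots,C_k\}$ is a partition and each $\xi_j(\rho)$ is an $s$-proof corresponding to $\rho$ whose leaves are axioms or proof terms for symbols in $R$. In $\xi_j(\rho)$ one may also use as axioms ($C_j$-axioms) sequents of atoms $u\circ v$ with $u,v\in T_0$, $\circ\in\{<,>,=,\le,\ge\}$, that are entailed by $C_j$ under the standard interpretation. (Since $\xi_j(\rho)$ is only used under $C_j$, the paper freely writes $\xi_j(\rho)$ with parameters replaced by values that $C_j$ forces, e.g. $P(0,0)$ for $P(x,y)$ under $x=0\land y=0$.) The associated point transition system has, for each $\rho$ and $j$, the transition $(\rho,t(\rho))\to\mathcal{L}_j:C_j$, where $\mathcal{L}_j$ is the set of pairs $(\rho',(u_1,\ldots,u_r))$ for proof terms $\rho'(u_1,\ldots,u_r)$ at leaves of $\xi_j(\rho)$ (or $\{(\delta_e,t(\rho))\}$, $\delta_e$ a fresh end label, if there are none).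 Write $\rho\to^*\rho'$ for the transitive closure of "$\rho'$ occurs in some $\mathcal{L}_j$ of $\rho$". The semi-proof schema is a *proof schema* if the system is canonic: there is a well-founded (Noetherian) strict ordering $<_l$ on tuples of numerals such that for every transition $(\rho,q)\to\mathcal{L}:C$ and every $(\rho',q')\in\mathcal{L}$, either ($\rho\to^*\rho'$ and not $\rho'\to^*\rho$), or ($\rho\to^*\rho'$, $\rho'\to^*\rho$ and $\sigma(q')<_l\sigma(q)$ for all $\sigma$ with $\sigma(C)=\top$). -}

module Defs where

open import Data.Fin.Base using (Fin; zero; suc)
open import Data.List.Base using (List; []; _∷_; _++_; map; concatMap)
open import Data.List.Membership.Propositional using (_∈_; _∉_)
open import Data.List.Relation.Binary.BagAndSetEquality using (_∼[_]_; set)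
open import Data.List.Relation.Binary.Permutation.Propositional using (_↭_)
open import Data.List.Relation.Binary.Subset.Propositional using (_⊆_)
open import Data.List.Relation.Unary.All using (All; []; _∷_)
open import Data.List.Relation.Unary.Any using (Any)
open import Data.List.Relation.Unary.Unique.Propositional using (Unique)
open import Data.Nat.Base as ℕ using (ℕ; zero; suc; _+_)
open import Data.Product using (Σ; Σ-syntax; ∃-syntax; ∃!; _×_; _,_; proj₁)
open import Data.Sum.Base using (_⊎_)
open import Data.Vec.Base using (Vec; []; _∷_)
open import Data.Unit.Base using (⊤)
open import Data.Empty using (⊥)
open import Function.Base using (_∘_; const)
open import Induction.WellFounded using (WellFounded)
open import Level using (0ℓ)
open import Relation.Binary.Construct.Closure.Transitive using (TransClosure)
open import Relation.Binary.Core using (Rel)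
open import Relation.Binary.PropositionalEquality using (_≡_; _≢_)
open import Relation.Binary.Structures using (IsStrictPartialOrder)
open import Relation.Nullary.Negation.Core using (¬_)

-- Parameters and ordinary free variables are both named by numbers; they are
-- kept disjoint by using different constructors of Term.

Param FVar : Set
Param = ℕ
FVar  = ℕ

data Cmp : Set where
  eq lt gt le ge : Cmp

⟦_⟧ : Cmp → ℕ → ℕ → Set
⟦ eq ⟧ = _≡_
⟦ lt ⟧ = ℕ._<_
⟦ gt ⟧ = ℕ._>_
⟦ le ⟧ = ℕ._≤_
⟦ ge ⟧ = ℕ._≥_

data T₀ : Set where
  param : Param → T₀
  zero  : T₀
  suc   : T₀ → T₀
  pred  : T₀ → T₀

Assignment : Set
Assignment = Param → ℕ

eval : Assignment → T₀ → ℕ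
eval σ (param m) = σ m
eval σ zero      = 0
eval σ (suc u)   = suc (eval σ u)
eval σ (pred u)  = ℕ.pred (eval σ u)

-- A total function, the identity being used where nothing is substituted.
-- A substitution is only ever applied to a sequent or a tuple, hence only its
-- values at finitely many parameters matter.

Subst : Set
Subst = Param → T₀

-- (α , v) △ const β  is  sᵅ(v) △ sᵝ(0);   (α , v) △ (β , w)  is  sᵅ(v) △ sᵝ(w).

data AtomicCond : Set where
  true false : AtomicCond
  num        : (α : ℕ) (v : Param) (△ : Cmp) (β : ℕ) → AtomicCond
  par        : (α : ℕ) (v : Param) (△ : Cmp) (β : ℕ) (w : Param) → v ≢ w → AtomicCond

data Cond : Set where
  atomic : AtomicCond → Cond
  not    : Cond → Cond
  and or : Cond → Cond → Cond

infix 4 _⊨ᵃ_ _⊨_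

_⊨ᵃ_ : Assignment → AtomicCond → Set
σ ⊨ᵃ true            = ⊤
σ ⊨ᵃ false           = ⊥
σ ⊨ᵃ num α v △ β     = ⟦ △ ⟧ (α + σ v) β
σ ⊨ᵃ par α v △ β w _ = ⟦ △ ⟧ (α + σ v) (β + σ w)

_⊨_ : Assignment → Cond → Set
σ ⊨ atomic c = σ ⊨ᵃ c
σ ⊨ not c    = ¬ (σ ⊨ c)
σ ⊨ and c d  = (σ ⊨ c) × (σ ⊨ d)
σ ⊨ or c d   = (σ ⊨ c) ⊎ (σ ⊨ d)

condParams : Cond → List Param
condParams (atomic true)              = []
condParams (atomic false)             = []
condParams (atomic (num _ v _ _))     = v ∷ []
condParams (atomic (par _ v _ _ w _)) = v ∷ w ∷ []
condParams (not c)                    = condParams c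
condParams (and c d)                  = condParams c ++ condParams d
condParams (or c d)                   = condParams c ++ condParams d

Partition : ∀ {k} → (Fin k → Cond) → Set
Partition C = ∀ σ → ∃! _≡_ (λ j → σ ⊨ C j)

record Transition (L : Set) : Set where
  field
    label   : L
    args    : List T₀
    targets : List (L × List T₀)
    cond    : Cond

record PointTransitionSystem (L : Set) : Set₁ where
  field
    Index      : Set
    transition : Index → Transition L

  open Transition public

  _⟶_ : Rel L 0ℓ
  δ ⟶ δ′ = ∃[ i ] label (transition i) ≡ δ × δ′ ∈ map proj₁ (targets (transition i))

  _⟶*_ : Rel L 0ℓ
  _⟶*_ = TransClosure _⟶_

  Decreasing : Rel (List ℕ) 0ℓ → Transition L → L × List T₀ → Set
  Decreasing _<ₗ_ τ (δ′ , q′) =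
      ((label τ ⟶* δ′) × ¬ (δ′ ⟶* label τ))
    ⊎ ((label τ ⟶* δ′) × (δ′ ⟶* label τ) ×
       (∀ σ → σ ⊨ cond τ → map (eval σ) q′ <ₗ map (eval σ) (args τ)))

  Canonic : Set₁
  Canonic = Σ (Rel (List ℕ) 0ℓ) λ _<ₗ_ →
      IsStrictPartialOrder _≡_ _<ₗ_
    × WellFounded _<ₗ_
    × (∀ i {pt} → pt ∈ targets (transition i) → Decreasing _<ₗ_ (transition i) pt)

-- The function and predicate symbols besides 0, s, p, =, <, >, ≤, ≥, N, P.

record Signature : Set₁ where
  field
    Fun       : Set
    funArity  : Fun → ℕ
    Pred      : Set
    predArity : Pred → ℕ

module Language (S : Signature) where
  open Signature S

  -- Bound variables are de Bruijn indices: Term n and Formula n may contain n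
  -- dangling indices, and the terms and formulas proper are those with n = 0.

  data Term (n : ℕ) : Set where
    param : Param → Term n
    free  : FVar → Term n
    bound : Fin n → Term n
    𝟎     : Term n
    s p   : Term n → Term n
    fun   : (f : Fun) → Vec (Term n) (funArity f) → Term n

  data Atom (n : ℕ) : Set where
    cmp : Cmp → Term n → Term n → Atom n
    N   : Term n → Atom n
    P   : Term n → Term n → Atom n
    prd : (q : Pred) → Vec (Term n) (predArity q) → Atom n

  infixr 8 _∧_
  infixr 7 _∨_
  infixr 6 _⇒_

  data Formula (n : ℕ) : Set where
    atom        : Atom n → Formula n
    neg         : Formula n → Formula n
    _∧_ _∨_ _⇒_ : Formula n → Formula n → Formula n
    all ex      : Formula (suc n) → Formula n

  -- Multisets are lists; permutations are one of the inferences below.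

  infix 4 _⊢_

  record Sequent : Set where
    constructor _⊢_
    field
      antecedent succedent : List (Formula 0)

  ⌜_⌝ : ∀ {n} → T₀ → Term n
  ⌜ param m ⌝ = param m
  ⌜ zero ⌝    = 𝟎
  ⌜ suc u ⌝   = s ⌜ u ⌝
  ⌜ pred u ⌝  = p ⌜ u ⌝

  module _ {A : Set} (f : Param → List A) (g : FVar → List A) where

    mutual
      collectₜ : ∀ {n} → Term n → List A
      collectₜ (param m)  = f m
      collectₜ (free a)   = g a
      collectₜ (bound _)  = []
      collectₜ 𝟎          = []
      collectₜ (s u)      = collectₜ u
      collectₜ (p u)      = collectₜ u
      collectₜ (fun _ us) = collectᵥ us

      collectᵥ : ∀ {n k} → Vec (Term n) k → List A
      collectᵥ []       = []
      collectᵥ (u ∷ us) = collectₜ u ++ collectᵥ us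

    collectₐ : ∀ {n} → Atom n → List A
    collectₐ (cmp _ u v) = collectₜ u ++ collectₜ v
    collectₐ (N u)       = collectₜ u
    collectₐ (P u v)     = collectₜ u ++ collectₜ v
    collectₐ (prd _ us)  = collectᵥ us

    collectᶠ : ∀ {n} → Formula n → List A
    collectᶠ (atom X) = collectₐ X
    collectᶠ (neg A)  = collectᶠ A
    collectᶠ (A ∧ B)  = collectᶠ A ++ collectᶠ B
    collectᶠ (A ∨ B)  = collectᶠ A ++ collectᶠ B
    collectᶠ (A ⇒ B)  = collectᶠ A ++ collectᶠ B
    collectᶠ (all A)  = collectᶠ A
    collectᶠ (ex A)   = collectᶠ A

    collect : Sequent → List A
    collect (Γ ⊢ Δ) = concatMap collectᶠ Γ ++ concatMap collectᶠ Δ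

  params : Sequent → List Param
  params = collect (_∷ []) (const [])

  freeVars : Sequent → List FVar
  freeVars = collect (const []) (_∷ [])

  -- Simultaneous replacement of parameters by θ and of dangling indices by κ.

  mutual
    substₜ : ∀ {m n} → (Param → Term n) → (Fin m → Term n) → Term m → Term n
    substₜ θ κ (param x)  = θ x
    substₜ θ κ (free a)   = free a
    substₜ θ κ (bound i)  = κ i
    substₜ θ κ 𝟎          = 𝟎
    substₜ θ κ (s u)      = s (substₜ θ κ u)
    substₜ θ κ (p u)      = p (substₜ θ κ u)
    substₜ θ κ (fun f us) = fun f (substᵥ θ κ us)

    substᵥ : ∀ {m n k} → (Param → Term n) → (Fin m → Term n) →
             Vec (Term m) k → Vec (Term n) k
    substᵥ θ κ []       = []
    substᵥ θ κ (u ∷ us) = substₜ θ κ u ∷ substᵥ θ κ us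

  substₐ : ∀ {m n} → (Param → Term n) → (Fin m → Term n) → Atom m → Atom n
  substₐ θ κ (cmp △ u v) = cmp △ (substₜ θ κ u) (substₜ θ κ v)
  substₐ θ κ (N u)       = N (substₜ θ κ u)
  substₐ θ κ (P u v)     = P (substₜ θ κ u) (substₜ θ κ v)
  substₐ θ κ (prd q us)  = prd q (substᵥ θ κ us)

  weaken : ∀ {n} → Term n → Term (suc n)
  weaken = substₜ param (bound ∘ suc)

  lift : ∀ {m n} → (Fin m → Term n) → Fin (suc m) → Term (suc n)
  lift κ zero    = bound zero
  lift κ (suc i) = weaken (κ i)

  -- Parameters are only ever replaced by T₀-terms, which exist in every scope.

  substᶠ : ∀ {m n} → Subst → (Fin m → Term n) → Formula m → Formula n
  substᶠ θ κ (atom X) = atom (substₐ (⌜_⌝ ∘ θ) κ X)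
  substᶠ θ κ (neg A)  = neg (substᶠ θ κ A)
  substᶠ θ κ (A ∧ B)  = substᶠ θ κ A ∧ substᶠ θ κ B
  substᶠ θ κ (A ∨ B)  = substᶠ θ κ A ∨ substᶠ θ κ B
  substᶠ θ κ (A ⇒ B)  = substᶠ θ κ A ⇒ substᶠ θ κ B
  substᶠ θ κ (all A)  = all (substᶠ θ (lift κ) A)
  substᶠ θ κ (ex A)   = ex (substᶠ θ (lift κ) A)

  infix 9 _[_] _⟨_⟩

  _[_] : Formula 1 → Term 0 → Formula 0
  A [ u ] = substᶠ param (const u) A

  _⟨_⟩ : Sequent → Subst → Sequent
  (Γ ⊢ Δ) ⟨ θ ⟩ = map (substᶠ θ bound) Γ ⊢ map (substᶠ θ bound) Δ

  -- Structures of first-order logic with equality: only = has a fixed meaning.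

  record Structure : Set₁ where
    field
      Dom                 : Set
      zeroᴹ               : Dom
      sᴹ pᴹ               : Dom → Dom
      funᴹ                : (f : Fun) → Vec Dom (funArity f) → Dom
      ltᴹ gtᴹ leᴹ geᴹ Pᴹ  : Dom → Dom → Set
      Nᴹ                  : Dom → Set
      predᴹ               : (q : Pred) → Vec Dom (predArity q) → Set

    module _ (ν : Param → Dom) (φ : FVar → Dom) where

      mutual
        value : Term 0 → Dom
        value (param m)  = ν m
        value (free a)   = φ a
        value (bound ())
        value 𝟎          = zeroᴹ
        value (s u)      = sᴹ (value u)
        value (p u)      = pᴹ (value u)
        value (fun f us) = funᴹ f (values us)

        values : ∀ {k} → Vec (Term 0) k → Vec Dom k
        values []       = []
        values (u ∷ us) = value u ∷ values us

      Holds : Atom 0 → Set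
      Holds (cmp eq u v) = value u ≡ value v
      Holds (cmp lt u v) = ltᴹ (value u) (value v)
      Holds (cmp gt u v) = gtᴹ (value u) (value v)
      Holds (cmp le u v) = leᴹ (value u) (value v)
      Holds (cmp ge u v) = geᴹ (value u) (value v)
      Holds (N u)        = Nᴹ (value u)
      Holds (P u v)      = Pᴹ (value u) (value v)
      Holds (prd q us)   = predᴹ q (values us)

  Valid : List (Atom 0) → List (Atom 0) → Set₁
  Valid X Y = (M : Structure) → let open Structure M in
    ∀ ν φ → All (Holds ν φ) X → Any (Holds ν φ) Y

  record Comparison : Set where
    constructor compare
    field
      rel       : Cmp
      lhs rhs   : T₀

  True : Assignment → Comparison → Set
  True σ (compare △ u v) = ⟦ △ ⟧ (eval σ u) (eval σ v)

  comparison : Comparison → Atom 0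
  comparison (compare △ u v) = cmp △ ⌜ u ⌝ ⌜ v ⌝

  Entails : Cond → List Comparison → List Comparison → Set
  Entails C X Y = ∀ σ → σ ⊨ C → All (True σ) X → Any (True σ) Y

  atomicSequent : List (Atom 0) → List (Atom 0) → Sequent
  atomicSequent X Y = map atom X ⊢ map atom Y

  data Axiom (C : Cond) : Sequent → Set₁ where
    tautology  : ∀ {X Y A} → A ∈ X → A ∈ Y → Axiom C (atomicSequent X Y)
    equational : ∀ {X Y} → Valid X Y → Axiom C (atomicSequent X Y)
    entailed   : ∀ X Y → Entails C X Y →
                 Axiom C (atomicSequent (map comparison X) (map comparison Y))

  infix 3 _▷_

  data _▷_ : List Sequent → Sequent → Set where
    exchange : ∀ {Γ Γ′ Δ Δ′} → Γ ↭ Γ′ → Δ ↭ Δ′ → (Γ ⊢ Δ) ∷ [] ▷ Γ′ ⊢ Δ′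
    weakₗ    : ∀ {Γ Δ A} → (Γ ⊢ Δ) ∷ [] ▷ A ∷ Γ ⊢ Δ
    weakᵣ    : ∀ {Γ Δ A} → (Γ ⊢ Δ) ∷ [] ▷ Γ ⊢ A ∷ Δ
    contrₗ   : ∀ {Γ Δ A} → (A ∷ A ∷ Γ ⊢ Δ) ∷ [] ▷ A ∷ Γ ⊢ Δ
    contrᵣ   : ∀ {Γ Δ A} → (Γ ⊢ A ∷ A ∷ Δ) ∷ [] ▷ Γ ⊢ A ∷ Δ
    cut      : ∀ {Γ Δ Γ′ Δ′ A} →
               (Γ ⊢ A ∷ Δ) ∷ (A ∷ Γ′ ⊢ Δ′) ∷ [] ▷ Γ ++ Γ′ ⊢ Δ ++ Δ′
    negₗ     : ∀ {Γ Δ A} → (Γ ⊢ A ∷ Δ) ∷ [] ▷ neg A ∷ Γ ⊢ Δ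
    negᵣ     : ∀ {Γ Δ A} → (A ∷ Γ ⊢ Δ) ∷ [] ▷ Γ ⊢ neg A ∷ Δ
    ∧ₗ₁      : ∀ {Γ Δ A B} → (A ∷ Γ ⊢ Δ) ∷ [] ▷ A ∧ B ∷ Γ ⊢ Δ
    ∧ₗ₂      : ∀ {Γ Δ A B} → (B ∷ Γ ⊢ Δ) ∷ [] ▷ A ∧ B ∷ Γ ⊢ Δ
    ∧ᵣ       : ∀ {Γ Δ Γ′ Δ′ A B} →
               (Γ ⊢ A ∷ Δ) ∷ (Γ′ ⊢ B ∷ Δ′) ∷ [] ▷ Γ ++ Γ′ ⊢ A ∧ B ∷ Δ ++ Δ′
    ∨ₗ       : ∀ {Γ Δ Γ′ Δ′ A B} →
               (A ∷ Γ ⊢ Δ) ∷ (B ∷ Γ′ ⊢ Δ′) ∷ [] ▷ A ∨ B ∷ Γ ++ Γ′ ⊢ Δ ++ Δ′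
    ∨ᵣ₁      : ∀ {Γ Δ A B} → (Γ ⊢ A ∷ Δ) ∷ [] ▷ Γ ⊢ A ∨ B ∷ Δ
    ∨ᵣ₂      : ∀ {Γ Δ A B} → (Γ ⊢ B ∷ Δ) ∷ [] ▷ Γ ⊢ A ∨ B ∷ Δ
    ⇒ₗ       : ∀ {Γ Δ Γ′ Δ′ A B} →
               (Γ ⊢ A ∷ Δ) ∷ (B ∷ Γ′ ⊢ Δ′) ∷ [] ▷ A ⇒ B ∷ Γ ++ Γ′ ⊢ Δ ++ Δ′
    ⇒ᵣ       : ∀ {Γ Δ A B} → (A ∷ Γ ⊢ B ∷ Δ) ∷ [] ▷ Γ ⊢ A ⇒ B ∷ Δ
    allₗ     : ∀ {Γ Δ A} (u : Term 0) → (A [ u ] ∷ Γ ⊢ Δ) ∷ [] ▷ all A ∷ Γ ⊢ Δ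
    allᵣ     : ∀ {Γ Δ A} (a : FVar) → a ∉ freeVars (Γ ⊢ all A ∷ Δ) →
               (Γ ⊢ A [ free a ] ∷ Δ) ∷ [] ▷ Γ ⊢ all A ∷ Δ
    exₗ      : ∀ {Γ Δ A} (a : FVar) → a ∉ freeVars (ex A ∷ Γ ⊢ Δ) →
               (A [ free a ] ∷ Γ ⊢ Δ) ∷ [] ▷ ex A ∷ Γ ⊢ Δ
    exᵣ      : ∀ {Γ Δ A} (u : Term 0) → (Γ ⊢ A [ u ] ∷ Δ) ∷ [] ▷ Γ ⊢ ex A ∷ Δ

  module Calculus {r : ℕ} (Seq : Fin r → Sequent) (C : Cond) where

    data Derivation : Sequent → Set₁ where
      axiom : ∀ {Q} → Axiom C Q → Derivation Q
      call  : ∀ ρ θ → Derivation (Seq ρ ⟨ θ ⟩)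
      infer : ∀ {Qs Q} → Qs ▷ Q → All Derivation Qs → Derivation Q

    mutual
      sequents : ∀ {Q} → Derivation Q → List Sequent
      sequents {Q} (axiom _)    = Q ∷ []
      sequents {Q} (call _ _)   = Q ∷ []
      sequents {Q} (infer _ ds) = Q ∷ sequents* ds

      sequents* : ∀ {Qs} → All Derivation Qs → List Sequent
      sequents* []       = []
      sequents* (d ∷ ds) = sequents d ++ sequents* ds

    mutual
      calls : ∀ {Q} → Derivation Q → List (Fin r × Subst)
      calls (axiom _)    = []
      calls (call ρ θ)   = (ρ , θ) ∷ []
      calls (infer _ ds) = calls* ds

      calls* : ∀ {Qs} → All Derivation Qs → List (Fin r × Subst)
      calls* []       = []
      calls* (d ∷ ds) = calls d ++ calls* ds

  open Calculus public using (Derivation)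

  -- The set N(ρ) is given by its enumeration t ρ.

  record SProof {r : ℕ} (t : Fin r → List Param) (Seq : Fin r → Sequent)
                (ρ : Fin r) (C : Cond) : Set₁ where
    field
      derivation       : Derivation Seq C (Seq ρ)
      derivationParams : concatMap params (Calculus.sequents Seq C derivation) ∼[ set ] t ρ

    proofTerms : List (Fin r × List T₀)
    proofTerms = map (λ (ρ′ , θ) → ρ′ , map θ (t ρ′)) (Calculus.calls Seq C derivation)

  record Definition {r : ℕ} (t : Fin r → List Param) (Seq : Fin r → Sequent)
                    (N₀ : List Param) (ρ : Fin r) : Set₁ where
    field
      #C        : ℕ
      C         : Fin #C → Cond
      C-params  : ∀ j → condParams (C j) ⊆ N₀
      partition : Partition C
      ξ         : ∀ j → SProof t Seq ρ (C j)

  -- Proof symbols are mere names, so the finite set R is Fin #R.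

  record SemiProofSchema : Set₁ where
    field
      #R         : ℕ
      ρ₀         : Fin #R
      N₀         : List Param
      t          : Fin #R → List Param
      Seq        : Fin #R → Sequent
      t-unique   : ∀ ρ → Unique (t ρ)
      t-params   : ∀ ρ → t ρ ⊆ N₀
      Seq-params : ∀ ρ → params (Seq ρ) ∼[ set ] t ρ
      Π          : ∀ ρ → Definition t Seq N₀ ρ

  data Label (r : ℕ) : Set where
    sym : Fin r → Label r
    δₑ  : Label r

  module _ (𝐒 : SemiProofSchema) where
    open SemiProofSchema 𝐒

    toTargets : List T₀ → List (Fin #R × List T₀) → List (Label #R × List T₀)
    toTargets q []         = (δₑ , q) ∷ []
    toTargets q (pt ∷ pts) = map (λ (ρ′ , q′) → sym ρ′ , q′) (pt ∷ pts)

    schemaTransition : ∀ ρ → Fin (Definition.#C (Π ρ)) → Transition (Label #R)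
    schemaTransition ρ j = record
      { label   = sym ρ
      ; args    = map param (t ρ)
      ; targets = toTargets (map param (t ρ)) (SProof.proofTerms (ξ j))
      ; cond    = C j
      } where open Definition (Π ρ)

    transitionSystem : PointTransitionSystem (Label #R)
    transitionSystem = record
      { Index      = Σ[ ρ ∈ Fin #R ] Fin (Definition.#C (Π ρ))
      ; transition = λ (ρ , j) → schemaTransition ρ j
      }

  record ProofSchema : Set₁ where
    field
      semiProofSchema : SemiProofSchema
      canonic         : PointTransitionSystem.Canonic (transitionSystem semiProofSchema)

    open SemiProofSchema semiProofSchema public

  module _ {n : ℕ} where

    infix 9 _≥ᶠ_ _>ᶠ_

    _≥ᶠ_ _>ᶠ_ Pᶠ : Term n → Term n → Formula n
    u ≥ᶠ v = atom (cmp ge u v)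
    u >ᶠ v = atom (cmp gt u v)
    Pᶠ u v = atom (P u v)

    Nᶠ : Term n → Formula n
    Nᶠ u = atom (N u)

    𝟏 : Term n
    𝟏 = s 𝟎

  pdef : List (Formula 0)
  pdef =
      Nᶠ 𝟎
    ∷ all (w ≥ᶠ 𝟏 ⇒ (Nᶠ w ⇒ Nᶠ (p w)))
    ∷ all (w ≥ᶠ 𝟏 ⇒ (Nᶠ (p w) ⇒ Nᶠ w))
    ∷ []
    where
    w : Term 1
    w = bound zero

  Ĥ : List (Formula 0)
  Ĥ =
      Pᶠ 𝟎 𝟎
    ∷ Pᶠ 𝟏 𝟎
    ∷ all (Nᶠ z ⇒ Pᶠ z 𝟏)
    ∷ all (all (Nᶠ u ∧ Nᶠ v ⇒ (u >ᶠ 𝟎 ∧ v >ᶠ 𝟏 ⇒ (Pᶠ (p u) (p (p v)) ⇒ Pᶠ u v))))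
    ∷ all (Nᶠ z ⇒ (z >ᶠ 𝟏 ⇒ (Pᶠ (p z) (p (p z)) ⇒ Pᶠ 𝟎 z)))
    ∷ all (Nᶠ z ⇒ (z >ᶠ 𝟏 ⇒ (Pᶠ (p z) (p (p z)) ⇒ Pᶠ z 𝟎)))
    ∷ []
    where
    z : Term 1
    z = bound zero
    u v : Term 2
    u = bound (suc zero)
    v = bound zero

  twoHydra : Param → Param → Sequent
  twoHydra x y =
    pdef ++ Ĥ ++ Nᶠ (param x) ∷ Nᶠ (param y) ∷ [] ⊢ Pᶠ (param x) (param y) ∷ []

{-# OPTIONS --safe #-}

-- Depending on which of x = 0, x = 1, x > 1 and y = 0, y = 1, y > 1 hold, exactly one
-- clause of Ĥ applies, and its premise, if any, is the two-hydra statement at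
-- (px, ppx), (py, ppy) or (px, ppy).  In each of these cases max(x, y) decreases, so
-- tuples compared by their maximum make the transition system canonic.

module Submission where

open import Defs
open import Data.Bool.Base using (if_then_else_)
open import Data.Fin using (Fin; #_)
open import Data.Fin.Patterns using (0F; 1F; 2F; 3F; 4F; 5F)
open import Data.List.Base using (List; []; _∷_; _++_; foldr; lookup; map)
open import Data.List.Membership.Propositional using (_∈_; lose)
open import Data.List.Membership.Propositional.Properties
  using (∈-∃++; ∈-++⁺ˡ; ∈-++⁺ʳ; ∈-++⁻; ∈-concatMap⁺; ∈-lookup; ∈-map⁺; ∈-map⁻)
open import Data.List.Relation.Binary.Permutation.Propositional
  using (_↭_; ↭-refl; ↭-sym; prep)
open import Data.List.Relation.Binary.Permutation.Propositional.Properties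
  using (shift; ++-comm; All-resp-↭)
open import Data.List.Relation.Binary.Subset.Propositional using (_⊆_)
open import Data.List.Relation.Unary.All as All using (All; []; _∷_)
open import Data.List.Relation.Unary.All.Properties using (++⁺; ++⁻ˡ; ++⁻ʳ; concat⁺; map⁺)
open import Data.List.Relation.Unary.AllPairs using ([]; _∷_)
open import Data.List.Relation.Unary.Any using (here; there)
open import Data.Nat.Base as ℕ using (ℕ; zero; suc; _<_; _>_; _⊔_; z≤n; s≤s)
open import Data.Nat.Induction using (<-wellFounded)
open import Data.Nat.Properties
  using (_≟_; <-irrefl; <-trans; <-≤-trans; <⇒≤; ≤-refl; ≤-trans; ≤-<-trans; ⊔-lub; pred[n]≤n;
         m≤m⊔n; suc[m]≤n⇒m≤pred[n]; m≤n⇒m≤o⊔n)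
open import Data.Product.Base using (Σ-syntax; _×_; _,_; proj₁; proj₂)
open import Data.Sum.Base using (inj₁; inj₂; [_,_]′)
open import Data.Vec.Base using (Vec; []; _∷_)
open import Function.Base using (const; id; _∘_; _on_)
open import Function.Bundles using (mk⇔)
open import Induction.WellFounded using (WellFounded)
open import Level using (0ℓ)
open import Relation.Binary.Construct.Closure.Transitive as Closure using (_∷_)
import Relation.Binary.Construct.On as On
open import Relation.Binary.Core using (Rel)
open import Relation.Binary.PropositionalEquality as ≡
  using (_≡_; _≢_; refl; subst; subst₂; isEquivalence; resp₂)
open import Relation.Binary.Structures using (IsStrictPartialOrder)
open import Relation.Nullary.Decidable using (does; dec-true; dec-false)
open import Relation.Nullary.Negation.Core using (¬_)

-- Tuples of numerals ordered by their maximum.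

maximum : List ℕ → ℕ
maximum = foldr _⊔_ 0

infix 4 _≺_

_≺_ : Rel (List ℕ) 0ℓ
_≺_ = _<_ on maximum

≺-wellFounded : WellFounded _≺_
≺-wellFounded = On.wellFounded maximum <-wellFounded

≺-isStrictPartialOrder : IsStrictPartialOrder _≡_ _≺_
≺-isStrictPartialOrder = record
  { isEquivalence = isEquivalence
  ; irrefl        = λ { refl → <-irrefl refl }
  ; trans         = <-trans
  ; <-resp-≈      = resp₂ _≺_
  }

pair-≺ : ∀ {a b} xs → a < maximum xs → b < maximum xs → a ∷ b ∷ [] ≺ xs
-- The fold in `maximum` ends in the default `0`, which must also lie strictly below `maximum xs`;
-- `a<` already forces that maximum to be positive.
pair-≺ _ a< b< = ⊔-lub a< (⊔-lub b< (≤-trans (s≤s z≤n) a<))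

pred-< : ∀ {n} → n > 0 → ℕ.pred n < n
pred-< (s≤s _) = ≤-refl

module _ (S : Signature) where
  open Language S

  -- Parameters under instantiation of bound variables.

  paramsₜ : ∀ {n} → Term n → List Param
  paramsₜ = collectₜ (_∷ []) (const [])

  paramsᵥ : ∀ {n k} → Vec (Term n) k → List Param
  paramsᵥ = collectᵥ (_∷ []) (const [])

  paramsₐ : ∀ {n} → Atom n → List Param
  paramsₐ = collectₐ (_∷ []) (const [])

  paramsᶠ : ∀ {n} → Formula n → List Param
  paramsᶠ = collectᶠ (_∷ []) (const [])

  module _ {π : Param → Set} where

    All-++⁻ : ∀ {xs xs′ ys ys′ : List Param} →
              (All π xs′ → All π xs) → (All π ys′ → All π ys) →
              All π (xs′ ++ ys′) → All π (xs ++ ys)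
    All-++⁻ {xs′ = xs′} f g h = ++⁺ (f (++⁻ˡ xs′ h)) (g (++⁻ʳ xs′ h))

    mutual
      instance⁻ₜ : ∀ {m n} (κ : Fin m → Term n) u →
                   All π (paramsₜ (substₜ param κ u)) → All π (paramsₜ u)
      instance⁻ₜ κ (param _)  h = h
      instance⁻ₜ κ (free _)   h = h
      instance⁻ₜ κ (bound _)  h = []
      instance⁻ₜ κ 𝟎          h = h
      instance⁻ₜ κ (s u)      h = instance⁻ₜ κ u h
      instance⁻ₜ κ (p u)      h = instance⁻ₜ κ u h
      instance⁻ₜ κ (fun _ us) h = instance⁻ᵥ κ us h

      instance⁻ᵥ : ∀ {m n k} (κ : Fin m → Term n) (us : Vec (Term m) k) →
                   All π (paramsᵥ (substᵥ param κ us)) → All π (paramsᵥ us)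
      instance⁻ᵥ κ []       = id
      instance⁻ᵥ κ (u ∷ us) = All-++⁻ (instance⁻ₜ κ u) (instance⁻ᵥ κ us)

    instance⁻ₐ : ∀ {m n} (κ : Fin m → Term n) X →
                 All π (paramsₐ (substₐ param κ X)) → All π (paramsₐ X)
    instance⁻ₐ κ (cmp _ u v) = All-++⁻ (instance⁻ₜ κ u) (instance⁻ₜ κ v)
    instance⁻ₐ κ (N u)       = instance⁻ₜ κ u
    instance⁻ₐ κ (P u v)     = All-++⁻ (instance⁻ₜ κ u) (instance⁻ₜ κ v)
    instance⁻ₐ κ (prd _ us)  = instance⁻ᵥ κ us

    -- Only indices are replaced, so every parameter occurrence of `A` survives in the instance.
    -- This is what `allₗ` needs, where scoping passes from the instance `A [ u ]` down to `all A`.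
    instance⁻ : ∀ {m n} (κ : Fin m → Term n) A →
                All π (paramsᶠ (substᶠ param κ A)) → All π (paramsᶠ A)
    instance⁻ κ (atom X) = instance⁻ₐ κ X
    instance⁻ κ (neg A)  = instance⁻ κ A
    instance⁻ κ (A ∧ B)  = All-++⁻ (instance⁻ κ A) (instance⁻ κ B)
    instance⁻ κ (A ∨ B)  = All-++⁻ (instance⁻ κ A) (instance⁻ κ B)
    instance⁻ κ (A ⇒ B)  = All-++⁻ (instance⁻ κ A) (instance⁻ κ B)
    instance⁻ κ (all A)  = instance⁻ (lift κ) A
    instance⁻ κ (ex A)   = instance⁻ (lift κ) A

  -- Derivations with their scoping and their calls under control.

  module Scoping {r : ℕ} (Seq : Fin r → Sequent) (C : Cond)
                 (π : Param → Set) (Good : Fin r × Subst → Set) where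

    open Calculus Seq C using (axiom; call; infer; sequents; calls)

    Scopedₜ : Term 0 → Set
    Scopedₜ u = All π (paramsₜ u)

    Scopedᶠ : Formula 0 → Set
    Scopedᶠ A = All π (paramsᶠ A)

    Scoped : Sequent → Set
    Scoped (Γ ⊢ Δ) = All Scopedᶠ Γ × All Scopedᶠ Δ

    Scoped⇒params : ∀ {Q} → Scoped Q → All π (params Q)
    Scoped⇒params (γ , δ) = ++⁺ (concat⁺ (map⁺ γ)) (concat⁺ (map⁺ δ))

    -- Both invariants are built along with the derivation: `scoped` bounds the parameters of the
    -- s-proof, and `good` records for each call the descent that canonicity asks for.
    record Proof (Q : Sequent) : Set₁ where
      field
        derivation : Derivation Seq C Q
        scoped     : All Scoped (sequents derivation)
        good       : All Good (calls derivation)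

    open Proof public

    conclusion∈ : ∀ {Q} (d : Derivation Seq C Q) → Q ∈ sequents d
    conclusion∈ (axiom _)   = here refl
    conclusion∈ (call _ _)  = here refl
    conclusion∈ (infer _ _) = here refl

    conclusion : ∀ {Q} → Proof Q → Scoped Q
    conclusion d = All.lookup (scoped d) (conclusion∈ (derivation d))

    infer₁ : ∀ {Q₁ Q} → Q₁ ∷ [] ▷ Q → (Scoped Q₁ → Scoped Q) → Proof Q₁ → Proof Q
    infer₁ R f d = record
      { derivation = infer R (derivation d ∷ [])
      ; scoped     = f (conclusion d) ∷ ++⁺ (scoped d) []
      ; good       = ++⁺ (good d) []
      }

    infer₂ : ∀ {Q₁ Q₂ Q} → Q₁ ∷ Q₂ ∷ [] ▷ Q → (Scoped Q₁ → Scoped Q₂ → Scoped Q) →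
             Proof Q₁ → Proof Q₂ → Proof Q
    infer₂ R f d e = record
      { derivation = infer R (derivation d ∷ derivation e ∷ [])
      ; scoped     = f (conclusion d) (conclusion e) ∷ ++⁺ (scoped d) (++⁺ (scoped e) [])
      ; good       = ++⁺ (good d) (++⁺ (good e) [])
      }

    axiomᵖ : ∀ {Q} → Axiom C Q → Scoped Q → Proof Q
    axiomᵖ a h = record { derivation = axiom a ; scoped = h ∷ [] ; good = [] }

    callᵖ : ∀ ρ θ → Scoped (Seq ρ ⟨ θ ⟩) → Good (ρ , θ) → Proof (Seq ρ ⟨ θ ⟩)
    callᵖ ρ θ h g = record { derivation = call ρ θ ; scoped = h ∷ [] ; good = g ∷ [] }

    permuteₗ : ∀ {Γ Γ′ Δ} → Γ ↭ Γ′ → Proof (Γ ⊢ Δ) → Proof (Γ′ ⊢ Δ)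
    permuteₗ σ = infer₁ (exchange σ ↭-refl) (λ (γ , δ) → All-resp-↭ σ γ , δ)

    -- The copy of `A` inside `Γ` is moved to the front, contracted with the extra one, and moved
    -- back.
    absorb : ∀ {A Γ Δ} → A ∈ Γ → Proof (A ∷ Γ ⊢ Δ) → Proof (Γ ⊢ Δ)
    absorb {A} A∈Γ d with xs , ys , refl ← ∈-∃++ A∈Γ =
      permuteₗ (↭-sym σ)
        (infer₁ contrₗ (λ { (_ ∷ γ , δ) → γ , δ }) (permuteₗ (prep A σ) d))
      where
      σ = shift A xs ys

    absorb* : ∀ {Γ Δ} Γ′ → Γ′ ⊆ Γ → Proof (Γ′ ++ Γ ⊢ Δ) → Proof (Γ ⊢ Δ)
    absorb* []       _ d = d
    absorb* (_ ∷ Γ′) i d = absorb* Γ′ (i ∘ there) (absorb (∈-++⁺ʳ Γ′ (i (here refl))) d)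

    weaken* : ∀ {Γ Γ′ Δ} → All Scopedᶠ Γ → Proof (Γ′ ⊢ Δ) → Proof (Γ ++ Γ′ ⊢ Δ)
    weaken* []      d = d
    weaken* (a ∷ γ) d = infer₁ weakₗ (λ (γ′ , δ) → a ∷ γ′ , δ) (weaken* γ d)

    -- Inclusion as sets suffices: all of `Γ` is weakened in, then each formula of `Γ′` is
    -- contracted into its copy in `Γ`. The multiplicative rules can thereby be used over one shared
    -- context.
    widen : ∀ {Γ Γ′ Δ} → All Scopedᶠ Γ → Γ′ ⊆ Γ → Proof (Γ′ ⊢ Δ) → Proof (Γ ⊢ Δ)
    widen {Γ} {Γ′} γ i d = absorb* Γ′ i (permuteₗ (++-comm Γ Γ′) (weaken* γ d))

    -- Single-succedent rules over a fixed antecedent Γ; A ⊸ B is the sequent in which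
    -- A is the formula being decomposed.

    module Over (Γ : List (Formula 0)) (γ : All Scopedᶠ Γ) where

      infix 3 ⊩_ _⊸_

      ⊩_ : Formula 0 → Set₁
      ⊩ A = Proof (Γ ⊢ A ∷ [])

      _⊸_ : Formula 0 → Formula 0 → Set₁
      A ⊸ B = Proof (A ∷ Γ ⊢ B ∷ [])

      ⊩⇒scoped : ∀ {A} → ⊩ A → Scopedᶠ A
      ⊩⇒scoped d = All.head (proj₂ (conclusion d))

      idₐ : ∀ {X} → Scopedᶠ (atom X) → atom X ⊸ atom X
      idₐ {X} h = widen (h ∷ γ) (λ { (here refl) → here refl })
        (axiomᵖ (tautology {X = X ∷ []} {Y = X ∷ []} (here refl) (here refl))
                (h ∷ [] , h ∷ []))

      entail : ∀ △ u v → Scopedₜ ⌜ u ⌝ → Scopedₜ ⌜ v ⌝ →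
               (∀ σ → σ ⊨ C → ⟦ △ ⟧ (eval σ u) (eval σ v)) →
               ⊩ atom (cmp △ ⌜ u ⌝ ⌜ v ⌝)
      entail △ u v hu hv f = widen γ (λ ())
        (axiomᵖ (entailed [] (compare △ u v ∷ []) (λ σ c _ → here (f σ c)))
                ([] , ++⁺ hu hv ∷ []))

      by : ∀ {A} i → lookup Γ i ⊸ A → ⊩ A
      by i = absorb (∈-lookup i)

      all-e : ∀ {A B} u → A [ u ] ⊸ B → all A ⊸ B
      all-e {A} u = infer₁ (allₗ u) (λ { (a ∷ γ′ , δ) → instance⁻ (const u) A a ∷ γ′ , δ })

      duplicate⊆ : Γ ++ Γ ⊆ Γ
      duplicate⊆ = [ id , id ]′ ∘ ∈-++⁻ Γ

      ⇒-e : ∀ {A B D} → ⊩ A → B ⊸ D → A ⇒ B ⊸ D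
      ⇒-e d e = widen (All.head (proj₁ (conclusion f)) ∷ γ)
        (λ { (here q) → here q ; (there m) → there (duplicate⊆ m) }) f
        where
        f = infer₂ ⇒ₗ
          (λ { (γ₁ , a ∷ _) (b ∷ γ₂ , δ) → ++⁺ a b ∷ ++⁺ γ₁ γ₂ , δ }) d e

      ∧-i : ∀ {A B} → ⊩ A → ⊩ B → ⊩ A ∧ B
      ∧-i d e = widen γ duplicate⊆ (infer₂ ∧ᵣ
        (λ { (γ₁ , a ∷ _) (γ₂ , b ∷ _) → ++⁺ γ₁ γ₂ , ++⁺ a b ∷ [] }) d e)

      -- Each cut adds a second copy of `Γ`, which `widen` merges with the first before the next
      -- formula is cut.
      cut* : ∀ {As B} → All ⊩_ As → Proof (As ++ Γ ⊢ B ∷ []) → ⊩ B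
      cut* [] e = e
      cut* {_ ∷ As} (d ∷ ds) e = cut* ds
        (widen (All.tail (proj₁ (conclusion e))) ([ ∈-++⁺ʳ As , id ]′ ∘ ∈-++⁻ Γ)
          (infer₂ cut (λ { (γ₁ , _) (_ ∷ γ₂ , δ) → ++⁺ γ₁ γ₂ , δ }) d e))

      -- Brings an axiom or a call, whose antecedent is prescribed, into the context `Γ`: the
      -- antecedent formulas not found in `Γ` are proved and cut.
      derive : ∀ {As Γ′ B} → All ⊩_ As → Γ′ ⊆ As ++ Γ → Proof (Γ′ ⊢ B ∷ []) → ⊩ B
      derive ds i e = cut* ds (widen (++⁺ (All.map ⊩⇒scoped ds) γ) i e)

      P-resp : ∀ {u u′ v v′} → Scopedₜ u′ → Scopedₜ v′ →
               ⊩ atom (cmp eq u u′) → ⊩ atom (cmp eq v v′) → ⊩ Pᶠ u v → ⊩ Pᶠ u′ v′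
      P-resp {u} {u′} {v} {v′} hu hv d e f =
        derive ds ∈-++⁺ˡ
          (axiomᵖ (equational {X = cmp eq u u′ ∷ cmp eq v v′ ∷ P u v ∷ []} {Y = P u′ v′ ∷ []}
                    λ { M ν φ (q ∷ r ∷ h ∷ []) → here (subst₂ (Structure.Pᴹ M) q r h) })
                  (All.map ⊩⇒scoped ds , ++⁺ hu hv ∷ []))
        where
        ds : All ⊩_ (atom (cmp eq u u′) ∷ atom (cmp eq v v′) ∷ Pᶠ u v ∷ [])
        ds = d ∷ e ∷ f ∷ []

  -- The Two-Hydra sequent and its recursive call.

  module TwoHydra (x y : Param) (x≢y : x ≢ y) where

    xy : List Param
    xy = x ∷ y ∷ []

    hyps : List (Formula 0)
    hyps = pdef ++ Ĥ ++ Nᶠ (param x) ∷ Nᶠ (param y) ∷ []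

    pdef↓ P₀₀ P₁₀ Hᵃ Hᵇ Hᶜ Hᵈ Nx Ny : Fin 11
    pdef↓ = # 1
    P₀₀   = # 3
    P₁₀   = # 4
    Hᵃ    = # 5
    Hᵇ    = # 6
    Hᶜ    = # 7
    Hᵈ    = # 8
    Nx    = # 9
    Ny    = # 10

    Seq : Fin 1 → Sequent
    Seq _ = twoHydra x y

    DecreasesUnder : Cond → Subst → Set
    DecreasesUnder C θ = ∀ σ → σ ⊨ C →
      map (eval σ) (map θ xy) ≺ map (eval σ) (map param xy)

    -- Maps `x` to `a` and all other parameters to `b`; among the parameters of `Seq` the only other
    -- one is `y`.
    _∣_ : T₀ → T₀ → Subst
    (a ∣ b) m = if does (m ≟ x) then a else b

    ∣-x : ∀ a b → (a ∣ b) x ≡ a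
    ∣-x _ _ rewrite dec-true (x ≟ x) refl = refl

    ∣-y : ∀ a b → (a ∣ b) y ≡ b
    ∣-y _ _ rewrite dec-false (y ≟ x) (x≢y ∘ ≡.sym) = refl

    size : Assignment → ℕ
    size σ = maximum (map (eval σ) (map param xy))

    x≤size : ∀ σ → σ x ℕ.≤ size σ
    x≤size σ = m≤m⊔n _ _

    y≤size : ∀ σ → σ y ℕ.≤ size σ
    y≤size σ = m≤n⇒m≤o⊔n (σ x) (m≤m⊔n _ _)

    module Case (C : Cond) where

      open Scoping Seq C (_∈ xy) (DecreasesUnder C ∘ proj₂) public

      x∈ : x ∈ xy
      x∈ = here refl

      y∈ : y ∈ xy
      y∈ = there (here refl)

      hyps-scoped : ∀ {Γ} → All Scopedᶠ Γ → All Scopedᶠ (pdef ++ Ĥ ++ Γ)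
      -- One `[]` for each of the nine formulas of `pdef` and `Ĥ`, none of which contains a
      -- parameter.
      hyps-scoped γ = [] ∷ [] ∷ [] ∷ [] ∷ [] ∷ [] ∷ [] ∷ [] ∷ [] ∷ γ

      open Over hyps (hyps-scoped ((x∈ ∷ []) ∷ (y∈ ∷ []) ∷ [])) public

      N-x : ⊩ Nᶠ (param x)
      N-x = by Nx (idₐ (x∈ ∷ []))

      N-y : ⊩ Nᶠ (param y)
      N-y = by Ny (idₐ (y∈ ∷ []))

      N-pred : ∀ u → (∀ σ → σ ⊨ C → eval σ u > 0) → ⊩ Nᶠ ⌜ u ⌝ → ⊩ Nᶠ (p ⌜ u ⌝)
      -- `eval σ u > 0` and `eval σ u ≥ 1` unfold to the same inequality.
      N-pred u u>0 d = by pdef↓ (all-e ⌜ u ⌝ (⇒-e (entail ge u (suc zero) h [] u>0)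
        (⇒-e d (idₐ h))))
        where h = ⊩⇒scoped d

      -- The formulas of `pdef` and `Ĥ` are fixed by `θ`, so the call leaves only `N a` and `N b` to
      -- be cut. The equations are arguments because `(a ∣ b) x` does not reduce for a variable `x`.
      recurse : ∀ (θ : Subst) {a b} → θ x ≡ a → θ y ≡ b →
                (∀ σ → σ ⊨ C → eval σ a < size σ) → (∀ σ → σ ⊨ C → eval σ b < size σ) →
                ⊩ Nᶠ ⌜ a ⌝ → ⊩ Nᶠ ⌜ b ⌝ → ⊩ Pᶠ ⌜ a ⌝ ⌜ b ⌝
      recurse θ refl refl a< b< d e = derive (d ∷ e ∷ [])
        ([ there ∘ there ∘ ∈-++⁺ˡ , ∈-++⁺ˡ ]′ ∘ ∈-++⁻ (pdef ++ Ĥ))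
        (callᵖ 0F θ (hyps-scoped (h ∷ k ∷ []) , ++⁺ h k ∷ [])
          (λ σ c → pair-≺ (map (eval σ) (map param xy)) (a< σ c) (b< σ c)))
        where
        h = ⊩⇒scoped d
        k = ⊩⇒scoped e

      -- The common premise of `Hᵇ`, `Hᶜ` and `Hᵈ`, taken at `(x , y)`, `(y , y)` and `(x , x)`.
      P-pred : ∀ u v → (∀ σ → eval σ u ℕ.≤ size σ) → (∀ σ → eval σ v ℕ.≤ size σ) →
               (∀ σ → σ ⊨ C → eval σ u > 0) → (∀ σ → σ ⊨ C → eval σ v > 1) →
               ⊩ Nᶠ ⌜ u ⌝ → ⊩ Nᶠ ⌜ v ⌝ → ⊩ Pᶠ (p ⌜ u ⌝) (p (p ⌜ v ⌝))
      P-pred u v u≤ v≤ u>0 v>1 d e =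
        recurse (pred u ∣ pred (pred v)) (∣-x _ _) (∣-y (pred u) _)
          (λ σ c → <-≤-trans (pred-< (u>0 σ c)) (u≤ σ))
          (λ σ c → ≤-<-trans pred[n]≤n (<-≤-trans (pred-< (v>0 σ c)) (v≤ σ)))
          (N-pred u u>0 d)
          -- Stepping down from `v` twice requires `pred v` to be positive, hence `v > 1`.
          (N-pred (pred v) (λ σ c → suc[m]≤n⇒m≤pred[n] (v>1 σ c)) (N-pred v v>0 e))
        where
        v>0 : ∀ σ → σ ⊨ C → eval σ v > 0
        v>0 σ c = <⇒≤ (v>1 σ c)

      -- The end sequent must literally speak of `x` and `y`, while the clauses of `Ĥ` may produce
      -- numerals; the equations forced by `C` are axioms and transport `P` along them.
      P-xy : ∀ u v → Scopedₜ ⌜ u ⌝ → Scopedₜ ⌜ v ⌝ →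
             (∀ σ → σ ⊨ C → eval σ u ≡ σ x) → (∀ σ → σ ⊨ C → eval σ v ≡ σ y) →
             ⊩ Pᶠ ⌜ u ⌝ ⌜ v ⌝ → ⊩ Pᶠ (param x) (param y)
      P-xy u v hu hv u=x v=y = P-resp (x∈ ∷ []) (y∈ ∷ [])
        (entail eq u (param x) hu (x∈ ∷ []) u=x) (entail eq v (param y) hv (y∈ ∷ []) v=y)

      sproof : ⊩ Pᶠ (param x) (param y) → SProof (const xy) Seq 0F C
      sproof d = record
        { derivation       = derivation d
        ; derivationParams = mk⇔
            (All.lookup (concat⁺ (map⁺ (All.map Scoped⇒params (scoped d)))))
            -- Conversely, `x` and `y` occur in the end sequent: its parameter list computes to
            -- `xy ++ xy`, the first copy coming from `N x` and `N y`.
            (λ m → ∈-concatMap⁺ params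
              (lose (conclusion∈ (derivation d)) (∈-++⁺ˡ {xs = xy} m)))
        }

    -- The partition into six conditions.

    xᶜ yᶜ : Cmp → ℕ → Cond
    xᶜ △ n = atomic (num 0 x △ n)
    yᶜ △ n = atomic (num 0 y △ n)

    C : Fin 6 → Cond
    C 0F = and (xᶜ eq 0) (yᶜ eq 0)
    C 1F = and (xᶜ eq 1) (yᶜ eq 0)
    C 2F = and (xᶜ gt 1) (yᶜ eq 0)
    C 3F = yᶜ eq 1
    C 4F = and (xᶜ eq 0) (yᶜ gt 1)
    C 5F = and (xᶜ gt 0) (yᶜ gt 1)

    C-params : ∀ j → condParams (C j) ⊆ xy
    C-params 0F = id
    C-params 1F = id
    C-params 2F = id
    C-params 3F = there
    C-params 4F = id
    C-params 5F = id

    -- The value of `y` comes first, so that `y = 1` is settled without splitting on `x`.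
    caseOf : ℕ → ℕ → Fin 6
    caseOf 0             0             = 0F
    caseOf 0             1             = 1F
    caseOf 0             (suc (suc _)) = 2F
    caseOf 1             _             = 3F
    caseOf (suc (suc _)) 0             = 4F
    caseOf (suc (suc _)) (suc _)       = 5F

    caseOf-holds : ∀ σ → σ ⊨ C (caseOf (σ y) (σ x))
    -- The selected condition mentions `σ x` and `σ y` anew once `caseOf` reduces, hence the saved
    -- equations.
    caseOf-holds σ with σ x in x≡ | σ y in y≡
    ... | 0           | 0           = x≡ , y≡
    ... | 1           | 0           = x≡ , y≡
    ... | suc (suc _) | 0           = subst (_> 1) (≡.sym x≡) (s≤s (s≤s z≤n)) , y≡
    ... | _           | 1           = y≡
    ... | 0           | suc (suc _) = x≡ , subst (_> 1) (≡.sym y≡) (s≤s (s≤s z≤n))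
    ... | suc _       | suc (suc _) =
      subst (_> 0) (≡.sym x≡) (s≤s z≤n) , subst (_> 1) (≡.sym y≡) (s≤s (s≤s z≤n))

    caseOf-unique : ∀ σ j → σ ⊨ C j → caseOf (σ y) (σ x) ≡ j
    caseOf-unique σ 0F (x≡ , y≡) rewrite x≡ | y≡ = refl
    caseOf-unique σ 1F (x≡ , y≡) rewrite x≡ | y≡ = refl
    caseOf-unique σ 2F (x> , y≡) rewrite y≡ with σ x | x>
    ... | _ | s≤s (s≤s _) = refl
    caseOf-unique σ 3F y≡ rewrite y≡ = refl
    caseOf-unique σ 4F (x≡ , y>) rewrite x≡ with σ y | y>
    ... | _ | s≤s (s≤s _) = refl
    caseOf-unique σ 5F (x> , y>) with σ x | x> | σ y | y>
    ... | _ | s≤s _ | _ | s≤s (s≤s _) = refl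

    -- The s-proof for each condition.

    proof : ∀ j → let open Case (C j) in ⊩ Pᶠ (param x) (param y)
    proof 0F = P-xy zero zero [] [] (λ _ (x≡ , _) → ≡.sym x≡) (λ _ (_ , y≡) → ≡.sym y≡)
      (by P₀₀ (idₐ []))
      where open Case (C 0F)
    proof 1F = P-xy (suc zero) zero [] [] (λ _ (x≡ , _) → ≡.sym x≡) (λ _ (_ , y≡) → ≡.sym y≡)
      (by P₁₀ (idₐ []))
      where open Case (C 1F)
    proof 2F = P-xy (param x) zero (x∈ ∷ []) [] (λ _ _ → refl) (λ _ (_ , y≡) → ≡.sym y≡)
      (by Hᵈ (all-e (param x) (⇒-e N-x (⇒-e
        (entail gt (param x) (suc zero) (x∈ ∷ []) [] (λ _ → proj₁)) (⇒-e
        (P-pred (param x) (param x) x≤size x≤size (λ _ → <⇒≤ ∘ proj₁) (λ _ → proj₁) N-x N-x)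
        (idₐ (x∈ ∷ [])))))))
      where open Case (C 2F)
    proof 3F = P-xy (param x) (suc zero) (x∈ ∷ []) [] (λ _ _ → refl) (λ _ y≡ → ≡.sym y≡)
      (by Hᵃ (all-e (param x) (⇒-e N-x (idₐ (x∈ ∷ [])))))
      where open Case (C 3F)
    proof 4F = P-xy zero (param y) [] (y∈ ∷ []) (λ _ (x≡ , _) → ≡.sym x≡) (λ _ _ → refl)
      (by Hᶜ (all-e (param y) (⇒-e N-y (⇒-e
        (entail gt (param y) (suc zero) (y∈ ∷ []) [] (λ _ → proj₂)) (⇒-e
        (P-pred (param y) (param y) y≤size y≤size (λ _ → <⇒≤ ∘ proj₂) (λ _ → proj₂) N-y N-y)
        (idₐ (y∈ ∷ [])))))))
      where open Case (C 4F)
    -- `Hᵇ` already concludes `P` at `x` and `y` themselves, so no transport by `P-xy` occurs here.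
    proof 5F = by Hᵇ (all-e (param x) (all-e (param y) (⇒-e (∧-i N-x N-y) (⇒-e
      (∧-i (entail gt (param x) zero (x∈ ∷ []) [] (λ _ → proj₁))
           (entail gt (param y) (suc zero) (y∈ ∷ []) [] (λ _ → proj₂))) (⇒-e
      (P-pred (param x) (param y) x≤size y≤size (λ _ → proj₁) (λ _ → proj₂) N-x N-y)
      (idₐ (x∈ ∷ y∈ ∷ [])))))))
      where open Case (C 5F)

    -- The proof schema and its canonicity.

    schema : SemiProofSchema
    schema = record
      { #R         = 1
      ; ρ₀         = 0F
      ; N₀         = xy
      ; t          = const xy
      ; Seq        = Seq
      ; t-unique   = λ _ → (x≢y ∷ []) ∷ [] ∷ []
      ; t-params   = λ _ → id
      ; Seq-params = λ _ → mk⇔ ([ id , id ]′ ∘ ∈-++⁻ xy) (∈-++⁺ˡ {xs = xy})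
      ; Π          = λ { 0F → record
          { #C        = 6
          ; C         = C
          ; C-params  = C-params
          ; partition = λ σ → caseOf (σ y) (σ x) , caseOf-holds σ , caseOf-unique σ _
          ; ξ         = λ j → Case.sproof (C j) (proof j)
          } }
      }

    open PointTransitionSystem (transitionSystem schema)

    δₑ-final : ∀ {δ} → ¬ (δₑ ⟶* δ)
    δₑ-final Closure.[ _ , () , _ ]
    δₑ-final ((_ , () , _) ∷ _)

    -- The target added for an empty list of calls carries `δₑ`, so a target labelled `sym` stems
    -- from an actual call.
    toTargets-All : ∀ (Q : Fin 1 → List T₀ → Set) {q} pts →
                    All (λ (ρ , q′) → Q ρ q′) pts →
                    ∀ {ρ q′} → (Label.sym ρ , q′) ∈ toTargets schema q pts → Q ρ q′
    toTargets-All _ []      _ (here ())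
    toTargets-All _ (_ ∷ _) h m with _ , m′ , refl ← ∈-map⁻ _ m = All.lookup h m′

    canonic : Canonic
    canonic = _≺_ , ≺-isStrictPartialOrder , ≺-wellFounded , decreasing
      where
      decreasing : ∀ i {pt} → pt ∈ targets (transition i) → Decreasing _≺_ (transition i) pt
      -- The end label is reached in one step and has no way back, so no descent is required.
      decreasing i {δₑ , _} m = inj₁ (Closure.[ i , refl , ∈-map⁺ proj₁ m ] , δₑ-final)
      -- The single symbol calls itself, so one transition witnesses reachability in both
      -- directions; the descent is the `good` field of the s-proof.
      decreasing i@(0F , j) {Label.sym 0F , _} m =
        inj₂ (loop , loop , toTargets-All
          (λ _ q → ∀ σ → σ ⊨ C j → map (eval σ) q ≺ map (eval σ) (map param xy))
          _ (map⁺ (Case.good (proof j))) m)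
        where loop = Closure.[ i , refl , ∈-map⁺ proj₁ m ]

theorem6p2 : (S : Signature) → let open Language S in
    (x y : Param) → x ≢ y →
    Σ[ 𝐏 ∈ ProofSchema ] let open ProofSchema 𝐏 in
    (#R ≡ 1)
    × (N₀ ≡ x ∷ y ∷ [])
    × (t ρ₀ ≡ x ∷ y ∷ [])
    × (Seq ρ₀ ≡ twoHydra x y)
theorem6p2 S x y x≢y =
  record { semiProofSchema = schema ; canonic = canonic } , refl , refl , refl , refl
  where open TwoHydra S x y x≢y
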